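{- For every integer $n\ge 0$, $\mathrm{cp}_{1,1,2}(n)=\mathcal{EO}^*(2n)$.
   Context: A partition of a non-negative integer $n$ is a finite multiset of positive integers (its parts) with sum $n$; the empty multiset $\emptyset$ is the unique partition of $0$. The size $|\lambda|$ of a partition $\lambda$ is the sum of its parts. For integers $a,b,m\ge 1$, an $(a,b,m)$-copartition is a triple of partitions $(\gamma,\rho,\sigma)$ such that each part of $\gamma$ is at least $a$ and congruent to $a \pmod m$, each part of $\sigma$ is at least $b$ and congruent to $b\pmod m$, and $\rho$ has the same number of parts as $\sigma$, each of which has size equal to $m$ times the number of parts of $\gamma$ (if $\gamma$ is empty, $\rho$ is regarded as empty). Its size is $|\gamma|+|\rho|+|\sigma|$. Let $\mathrm{cp}_{a,b,m}(n)$ denote the number of $(a,b,m)$-copartitions of size $n$. $\mathcal{EO}^*(n)$ denotes the number of partitions of $n$ in which all even parts are smaller than all odd parts and the only part size appearing an odd number of times is the largest even part. That is: if there is at least one even part, then the largest even part appears an odd number of times and every other part size appears an even number of times; if there are no even parts, then every part size appears an even number of times. In particular $\mathcal{EO}^*(0)=1$. -}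

module Defs where

open import Data.Nat using (ℕ; zero; suc; _+_; _*_; _≤_; _<_; _≥_; z≤n; s≤s; NonZero)
open import Data.Nat.Properties
  using (_≟_; _≤?_; _<?_; _≥?_; suc-injective; ≤-refl; ≤-trans; m≤m+n; m≤n+m; +-mono-≤)
open import Data.Nat.DivMod using (_%_)
open import Data.Nat.Divisibility using (_∣_; _∤_; _∣?_)
open import Data.List using (List; []; _∷_; length; map; filter; upTo;
  cartesianProduct; cartesianProductWith)
open import Data.Nat.ListAction using (sum)
open import Data.List.Properties using (∷-injective)
open import Data.List.Relation.Unary.All as All using (All; []; _∷_; all?)
open import Data.List.Relation.Unary.Any using (here; there)
open import Data.List.Relation.Unary.Linked using (Linked; linked?)
open import Data.List.Relation.Unary.AllPairs using ([]; _∷_)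
open import Data.List.Relation.Unary.Unique.Propositional using (Unique)
import Data.List.Relation.Unary.Unique.Propositional.Properties as Unique
open import Data.List.Membership.Propositional using (_∈_)
open import Data.List.Membership.Propositional.Properties
  using (∈-map⁺; ∈-upTo⁺; ∈-cartesianProductWith⁺; ∈-cartesianProductWith⁻;
         ∈-cartesianProduct⁺; ∈-filter⁺; ∈-filter⁻)
open import Data.Product using (_×_; _,_; proj₂)
open import Function.Bundles using (_⇔_; mk⇔)
open import Relation.Binary.PropositionalEquality using (_≡_; _≢_; refl)
open import Relation.Nullary using (¬_; Dec; yes; no)
open import Relation.Nullary.Decidable using (_×-dec_; _→-dec_; ¬?)

-- A multiset of positive integers is represented by its unique weakly
-- decreasing listing.
IsPartition : List ℕ → Set
IsPartition xs = Linked _≥_ xs × All (1 ≤_) xs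

isPartition? : ∀ xs → Dec (IsPartition xs)
isPartition? xs = linked? _≥?_ xs ×-dec all? (1 ≤?_) xs

-- All lists of length at most l with entries in {1, …, n}.
words : ℕ → ℕ → List (List ℕ)
words n zero    = [] ∷ []
words n (suc l) = [] ∷ cartesianProductWith _∷_ (map suc (upTo n)) (words n l)

words-unique : ∀ n l → Unique (words n l)
words-unique n zero    = [] ∷ []
words-unique n (suc l) = All.tabulate []≢ ∷
  Unique.cartesianProductWith⁺ _∷_ ∷-injective
    (Unique.map⁺ suc-injective (Unique.upTo⁺ n)) (words-unique n l)
  where
  []≢ : ∀ {ys} → ys ∈ cartesianProductWith _∷_ (map suc (upTo n)) (words n l) → [] ≢ ys
  []≢ p refl with ∈-cartesianProductWith⁻ _∷_ (map suc (upTo n)) (words n l) p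
  ... | _ , _ , _ , _ , ()

∈-words : ∀ {n l xs} → All (1 ≤_) xs → sum xs ≤ n → length xs ≤ l → xs ∈ words n l
∈-words {l = zero}  []            _ _         = here refl
∈-words {l = suc _} []            _ _         = here refl
∈-words {l = suc _} {xs = suc x ∷ xs} (s≤s _ ∷ ps) s (s≤s q) = there
  (∈-cartesianProductWith⁺ _∷_
    (∈-map⁺ suc (∈-upTo⁺ (≤-trans (m≤m+n (suc x) (sum xs)) s)))
    (∈-words ps (≤-trans (m≤n+m (sum xs) (suc x)) s) q))

length≤sum : ∀ {xs} → All (1 ≤_) xs → length xs ≤ sum xs
length≤sum []       = z≤n
length≤sum (p ∷ ps) = +-mono-≤ p (length≤sum ps)

partition∈words : ∀ {n xs} → IsPartition xs → sum xs ≤ n → xs ∈ words n n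
partition∈words (_ , pos) s = ∈-words pos s (≤-trans (length≤sum pos) s)

Triple : Set
Triple = List ℕ × List ℕ × List ℕ

triples : ℕ → List Triple
triples n = cartesianProduct (words n n) (cartesianProduct (words n n) (words n n))

size : Triple → ℕ
size (γ , ρ , σ) = sum γ + (sum ρ + sum σ)

module _ (a b m : ℕ) .{{_ : NonZero a}} .{{_ : NonZero b}} .{{_ : NonZero m}} where

  IsRectangle : (γ ρ σ : List ℕ) → Set
  IsRectangle []        ρ σ = ρ ≡ []
  IsRectangle γ@(_ ∷ _) ρ σ = length ρ ≡ length σ × All (_≡ m * length γ) ρ

  IsCopartition : Triple → Set
  IsCopartition (γ , ρ , σ) =
      (IsPartition γ × IsPartition ρ × IsPartition σ)
    × All (λ x → a ≤ x × x % m ≡ a % m) γ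
    × All (λ x → b ≤ x × x % m ≡ b % m) σ
    × IsRectangle γ ρ σ

  isRectangle? : ∀ γ ρ σ → Dec (IsRectangle γ ρ σ)
  isRectangle? []        []      σ = yes refl
  isRectangle? []        (_ ∷ _) σ = no λ ()
  isRectangle? γ@(_ ∷ _) ρ       σ =
    (length ρ ≟ length σ) ×-dec all? (_≟ m * length γ) ρ

  isCopartition? : ∀ t → Dec (IsCopartition t)
  isCopartition? (γ , ρ , σ) =
          (isPartition? γ ×-dec isPartition? ρ ×-dec isPartition? σ)
    ×-dec all? (λ x → (a ≤? x) ×-dec (x % m ≟ a % m)) γ
    ×-dec all? (λ x → (b ≤? x) ×-dec (x % m ≟ b % m)) σ
    ×-dec isRectangle? γ ρ σ

  isCopartitionOf? : ∀ n t → Dec (IsCopartition t × size t ≡ n)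
  isCopartitionOf? n t = isCopartition? t ×-dec (size t ≟ n)

  copartitions : ℕ → List Triple
  copartitions n = filter (isCopartitionOf? n) (triples n)

  -- Together with uniqueness, this says that the length of the list is the
  -- number of copartitions of size n.
  ∈-copartitions : ∀ {n t} → t ∈ copartitions n ⇔ (IsCopartition t × size t ≡ n)
  ∈-copartitions {n} {t@(γ , ρ , σ)} = mk⇔
    (λ t∈ → proj₂ (∈-filter⁻ (isCopartitionOf? n) {xs = triples n} t∈))
    (λ { p@(((pγ , pρ , pσ) , _) , refl) → ∈-filter⁺ (isCopartitionOf? n)
      (∈-cartesianProduct⁺
        (partition∈words pγ (m≤m+n (sum γ) (sum ρ + sum σ)))
        (∈-cartesianProduct⁺
          (partition∈words pρ (≤-trans (m≤m+n (sum ρ) (sum σ)) (m≤n+m _ (sum γ))))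
          (partition∈words pσ (≤-trans (m≤n+m (sum σ) (sum ρ)) (m≤n+m _ (sum γ))))))
      p })

  copartitions-unique : ∀ n → Unique (copartitions n)
  copartitions-unique n = Unique.filter⁺ (isCopartitionOf? n)
    (Unique.cartesianProduct⁺ (words-unique n n)
      (Unique.cartesianProduct⁺ (words-unique n n) (words-unique n n)))

  cp : ℕ → ℕ
  cp n = length (copartitions n)

multiplicity : ℕ → List ℕ → ℕ
multiplicity x xs = length (filter (x ≟_) xs)

EvensBelowOdds : List ℕ → Set
EvensBelowOdds xs = All (λ x → All (λ y → 2 ∣ x → 2 ∤ y → x < y) xs) xs

-- Applied only to x that is a part of xs.
IsLargestEven : List ℕ → ℕ → Set
IsLargestEven xs x = 2 ∣ x × All (λ y → 2 ∣ y → y ≤ x) xs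

-- If xs has no even part then no part is a largest even part, so every
-- multiplicity is required to be even.
IsEO* : List ℕ → Set
IsEO* xs = IsPartition xs × EvensBelowOdds xs ×
  All (λ x → (IsLargestEven xs x → 2 ∤ multiplicity x xs)
           × (¬ IsLargestEven xs x → 2 ∣ multiplicity x xs)) xs

isLargestEven? : ∀ xs x → Dec (IsLargestEven xs x)
isLargestEven? xs x = (2 ∣? x) ×-dec all? (λ y → (2 ∣? y) →-dec (y ≤? x)) xs

isEO*? : ∀ xs → Dec (IsEO* xs)
isEO*? xs = isPartition? xs
  ×-dec all? (λ x → all? (λ y → (2 ∣? x) →-dec (¬? (2 ∣? y) →-dec (x <? y))) xs) xs
  ×-dec all? (λ x → (isLargestEven? xs x →-dec ¬? (2 ∣? multiplicity x xs))
               ×-dec (¬? (isLargestEven? xs x) →-dec (2 ∣? multiplicity x xs))) xs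

isEO*Of? : ∀ n xs → Dec (IsEO* xs × sum xs ≡ n)
isEO*Of? n xs = isEO*? xs ×-dec (sum xs ≟ n)

EO*-partitions : ℕ → List (List ℕ)
EO*-partitions n = filter (isEO*Of? n) (words n n)

∈-EO*-partitions : ∀ {n xs} → xs ∈ EO*-partitions n ⇔ (IsEO* xs × sum xs ≡ n)
∈-EO*-partitions {n} {xs} = mk⇔
  (λ xs∈ → proj₂ (∈-filter⁻ (isEO*Of? n) {xs = words n n} xs∈))
  (λ { p@((pxs , _) , refl) → ∈-filter⁺ (isEO*Of? n) (partition∈words pxs ≤-refl) p })

EO*-partitions-unique : ∀ n → Unique (EO*-partitions n)
EO*-partitions-unique n = Unique.filter⁺ (isEO*Of? n) (words-unique n n)

EO* : ℕ → ℕ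
EO* n = length (EO*-partitions n)

{-# OPTIONS --safe #-}
module Submission where

-- Both sides count pairs (δ , τ) of weakly decreasing lists of naturals, where
-- zero entries are allowed, so that the lengths s of δ and r of τ are data.
--
-- A (1,1,2)-copartition consists of two partitions γ and σ into odd parts, with
-- entries 1 + 2d for d in δ and 1 + 2t for t in τ; the rectangle ρ is determined
-- by r and s and has size 2rs. Hence its size is s + 2|δ| + 2rs + r + 2|τ|.
--
-- A partition counted by EO* lists its odd parts before its even parts. In a
-- weakly decreasing list in which every multiplicity is even the entries pair
-- up, so the odd parts are a list repeated twice, and so are the even parts
-- once one copy of the largest even part is removed. From (δ , τ) such a
-- partition is built as follows: its largest even part is 2r (there are no even
-- parts if r = 0), its other even parts are twice the parts of the conjugate
-- of τ, each repeated twice, and its odd parts are 1 + 2(r + d) for d in δ, each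
-- repeated twice. Conjugation is what makes this fit: it identifies weakly
-- decreasing lists of length r with partitions into parts at most r
-- (conjugate-injective, conjugate-surjective) and preserves the sum. The sum
-- obtained is 2s(1 + 2r) + 4|δ| + 2r + 4|τ|, twice the size of the copartition
-- (sum-partitionEO*).
--
-- Both parametrisations are injective and exhaust the objects to be counted
-- (the lemmas copartition-* and partitionEO*-*), so the relation of having the
-- same parameters is a one-to-one correspondence, and two applications of
-- length-≤ give the two inequalities.

open import Defs
open import Data.Nat using (ℕ; _*_)
open import Relation.Binary.PropositionalEquality using (_≡_)

open import Data.Nat using (zero; suc; _+_; _∸_; _≤_; _<_; _≥_; _>_; z≤n; s≤s; _≤?_)
open import Data.Nat.Properties
open import Data.Nat.DivMod using (_%_; _/_; m≡m%n+[m/n]*n; m%n<n; [m+kn]%n≡m%n)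
open import Data.Nat.Divisibility
  using (_∣_; _∤_; _∣?_; divides; m∣m*n; ∣m+n∣m⇒∣n; ∣1⇒≡1)
open import Data.Nat.ListAction using (sum)
open import Data.Nat.ListAction.Properties using (sum-++)
open import Data.Nat.Tactic.RingSolver using (solve-∀)
open import Data.List using (List; []; _∷_; _++_; length; map; filter; replicate)
open import Data.List.Properties
  using (∷-injective; length-map; length-++; length-++-sucʳ; length-replicate;
         map-injective; filter-++; filter-accept; filter-reject; filter-none)
open import Data.List.Membership.Propositional using (_∈_)
open import Data.List.Membership.Propositional.Properties
  using (∈-++⁻; ∈-++⁺ˡ; ∈-++⁺ʳ; ∈-∃++)
open import Data.List.Relation.Unary.All as All using (All; []; _∷_)
import Data.List.Relation.Unary.All.Properties as All
open import Data.List.Relation.Unary.AllPairs as AllPairs using (AllPairs; []; _∷_)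
import Data.List.Relation.Unary.AllPairs.Properties as AllPairs
open import Data.List.Relation.Unary.Any using (here; there)
open import Data.List.Relation.Unary.Linked.Properties
  using (Linked⇒AllPairs; AllPairs⇒Linked)
open import Data.List.Relation.Unary.Unique.Propositional using (Unique)
open import Data.Product using (∃; ∃₂; _×_; _,_; proj₁; proj₂)
open import Data.Sum using (_⊎_; inj₁; inj₂)
open import Function.Base using (_∘_)
open import Function.Bundles using (module Equivalence)
open import Relation.Binary.PropositionalEquality
  using (_≢_; refl; sym; trans; cong; cong₂; subst; module ≡-Reasoning)
open import Relation.Nullary using (¬_; Dec; yes; no; contradiction)
open import Relation.Nullary.Decidable using (¬?; decidable-stable)
open import Relation.Unary using (Decidable)

-- Lists and counting

∃-map : ∀ {A B : Set} {f : A → B} {xs} →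
        All (λ x → ∃ λ y → f y ≡ x) xs → ∃ λ ys → map f ys ≡ xs
∃-map []               = [] , refl
∃-map ((y , eq) ∷ eqs) with ∃-map eqs
... | ys , eq′ = y ∷ ys , cong₂ _∷_ eq eq′

All≡⇒replicate : ∀ {A : Set} {x : A} {xs} → All (_≡ x) xs → xs ≡ replicate (length xs) x
All≡⇒replicate []           = refl
All≡⇒replicate (refl ∷ eqs) = cong (_ ∷_) (All≡⇒replicate eqs)

tabulatePairs : ∀ {A : Set} {R : A → A → Set} xs →
                (∀ {x y} → x ∈ xs → y ∈ xs → R x y) → AllPairs R xs
tabulatePairs []       r = []
tabulatePairs (x ∷ xs) r =
  All.tabulate (λ y∈ → r (here refl) (there y∈)) ∷
  tabulatePairs xs (λ x∈ y∈ → r (there x∈) (there y∈))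

AllPairs-++⁻ : ∀ {A : Set} {R : A → A → Set} xs {ys} → AllPairs R (xs ++ ys) →
               AllPairs R xs × AllPairs R ys
AllPairs-++⁻ []       rs       = [] , rs
AllPairs-++⁻ (x ∷ xs) (r ∷ rs) with AllPairs-++⁻ xs rs
... | rxs , rys = All.++⁻ˡ xs r ∷ rxs , rys

module _ {A : Set} {P : A → Set} where

  -- If failure of P propagates to the right, then P holds exactly on a prefix.
  prefix-split : ∀ {R : A → A → Set} → Decidable P →
                 (∀ {x y} → R x y → ¬ P x → ¬ P y) → ∀ {xs} → AllPairs R xs →
                 ∃₂ λ as bs → xs ≡ as ++ bs × All P as × All (¬_ ∘ P) bs
  prefix-split P? pres []               = [] , [] , refl , [] , []
  prefix-split P? pres {x ∷ xs} (r ∷ rs) with P? x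
  ... | no ¬px = [] , x ∷ xs , refl , [] , ¬px ∷ All.map (λ rxy → pres rxy ¬px) r
  ... | yes px with prefix-split P? pres rs
  ...   | as , bs , eq , pas , ¬pbs = x ∷ as , bs , cong (x ∷_) eq , px ∷ pas , ¬pbs

  prefix-split-unique : ∀ {as as′ bs bs′} → All P as → All P as′ →
                        All (¬_ ∘ P) bs → All (¬_ ∘ P) bs′ →
                        as ++ bs ≡ as′ ++ bs′ → as ≡ as′ × bs ≡ bs′
  prefix-split-unique []       []       _         _         eq   = refl , eq
  prefix-split-unique []       (p ∷ _)  (¬p ∷ _)  _         refl = contradiction p ¬p
  prefix-split-unique (p ∷ _)  []       _         (¬p ∷ _)  refl = contradiction p ¬p
  prefix-split-unique (_ ∷ ps) (_ ∷ qs) ¬ps       ¬qs       eq with ∷-injective eq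
  ... | refl , eq′ with prefix-split-unique ps qs ¬ps ¬qs eq′
  ...   | refl , eq″ = refl , eq″

-- A relation that is total on xs, lands in ys, and relates each y to at most
-- one x, bounds the length of a duplicate-free xs by that of ys.
length-≤ : ∀ {A B : Set} {R : A → B → Set} →
           (∀ {x x′ y} → R x y → R x′ y → x ≡ x′) →
           ∀ {xs} ys → Unique xs → (∀ {x} → x ∈ xs → ∃ λ y → y ∈ ys × R x y) →
           length xs ≤ length ys
length-≤ inj ys []            tot = z≤n
length-≤ {R = R} inj ys (x∉ ∷ uniq) tot with tot (here refl)
... | y , y∈ , rxy with ∈-∃++ y∈
... | ys₁ , ys₂ , refl =
  ≤-trans (s≤s (length-≤ inj (ys₁ ++ ys₂) uniq tot′))
          (≤-reflexive (sym (length-++-sucʳ ys₁ y ys₂)))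
  where
  tot′ : ∀ {x′} → x′ ∈ _ → ∃ λ y′ → y′ ∈ ys₁ ++ ys₂ × R x′ y′
  -- The partner of x′ is not y, since y is related to x only.
  tot′ x′∈ with tot (there x′∈)
  ... | y′ , y′∈ , rxy′ with ∈-++⁻ ys₁ y′∈
  ... | inj₁ y′∈₁          = y′ , ∈-++⁺ˡ y′∈₁ , rxy′
  ... | inj₂ (here refl)   = contradiction (inj rxy rxy′) (All.lookup x∉ x′∈)
  ... | inj₂ (there y′∈₂)  = y′ , ∈-++⁺ʳ ys₁ y′∈₂ , rxy′

-- Parity

2∤suc : ∀ {n} → 2 ∣ n → 2 ∤ suc n
2∤suc {n} 2∣n 2∣1+n
  with () ← ∣1⇒≡1 (∣m+n∣m⇒∣n (subst (2 ∣_) (sym (+-comm n 1)) 2∣1+n) 2∣n)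

-- The odd number with index d, so that d ranges over all naturals.
odd : ℕ → ℕ
odd d = suc (2 * d)

2∤odd : ∀ d → 2 ∤ odd d
2∤odd d = 2∤suc (m∣m*n d)

odd-injective : ∀ {d e} → odd d ≡ odd e → d ≡ e
odd-injective {d} {e} eq = *-cancelˡ-≡ d e 2 (suc-injective eq)

odd%2 : ∀ d → odd d % 2 ≡ 1
odd%2 d = trans (cong (λ n → suc n % 2) (*-comm 2 d)) ([m+kn]%n≡m%n 1 d 2)

%2≡1⇒odd : ∀ {x} → x % 2 ≡ 1 → ∃ λ d → odd d ≡ x
%2≡1⇒odd {x} eq = x / 2 , sym (trans (m≡m%n+[m/n]*n x 2)
  (cong₂ _+_ eq (*-comm (x / 2) 2)))

2∤⇒odd : ∀ {x} → 2 ∤ x → ∃ λ d → odd d ≡ x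
2∤⇒odd {x} 2∤x with x % 2 in eq | m%n<n x 2
... | 0           | _ = contradiction
  (divides (x / 2) (trans (m≡m%n+[m/n]*n x 2) (cong (_+ x / 2 * 2) eq))) 2∤x
... | 1           | _ = %2≡1⇒odd eq
... | suc (suc _) | s≤s (s≤s ())

2∣⇒double : ∀ {x} → 2 ∣ x → ∃ λ k → 2 * k ≡ x
2∣⇒double (divides k eq) = k , trans (*-comm 2 k) (sym eq)

2∤suc⇒2∣ : ∀ {n} → 2 ∤ suc n → 2 ∣ n
2∤suc⇒2∣ {n} 2∤1+n with 2 ∣? n
... | yes 2∣n = 2∣n
... | no  2∤n with 2∤⇒odd 2∤n
...   | d , refl = contradiction
  (divides (suc d) (trans (sym (*-suc 2 d)) (*-comm 2 (suc d)))) 2∤1+n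

-- Weakly decreasing lists and multiplicities

-- Weakly decreasing lists. All pairs are compared, rather than adjacent ones,
-- so that a bound on the whole tail is available at every entry.
Decreasing : List ℕ → Set
Decreasing = AllPairs _≥_

replicate-decreasing : ∀ n x → Decreasing (replicate n x)
replicate-decreasing zero    x = []
replicate-decreasing (suc n) x = All.replicate⁺ n ≤-refl ∷ replicate-decreasing n x

partition⇒decreasing : ∀ {xs} → IsPartition xs → Decreasing xs
partition⇒decreasing = Linked⇒AllPairs (λ p q → ≤-trans q p) ∘ proj₁

multiplicity-here : ∀ x xs → multiplicity x (x ∷ xs) ≡ suc (multiplicity x xs)
multiplicity-here x xs = cong length (filter-accept (x ≟_) refl)

multiplicity-there : ∀ {x y} xs → x ≢ y → multiplicity x (y ∷ xs) ≡ multiplicity x xs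
multiplicity-there {x} xs x≢y = cong length (filter-reject (x ≟_) x≢y)

multiplicity-++ : ∀ x xs ys → multiplicity x (xs ++ ys) ≡ multiplicity x xs + multiplicity x ys
multiplicity-++ x xs ys =
  trans (cong length (filter-++ (x ≟_) xs ys)) (length-++ (filter (x ≟_) xs))

multiplicity-none : ∀ {x xs} → All (x ≢_) xs → multiplicity x xs ≡ 0
multiplicity-none {x} x∉ = cong length (filter-none (x ≟_) x∉)

-- Each entry of the list, repeated twice in a row.
double : List ℕ → List ℕ
double []       = []
double (x ∷ xs) = x ∷ x ∷ double xs

double-injective : ∀ {xs ys} → double xs ≡ double ys → xs ≡ ys
double-injective {[]}    {[]}    _    = refl
double-injective {_ ∷ _} {_ ∷ _} eq with ∷-injective eq
... | refl , eq′ = cong (_ ∷_) (double-injective (proj₂ (∷-injective eq′)))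

sum-double : ∀ xs → sum (double xs) ≡ 2 * sum xs
sum-double []       = refl
sum-double (x ∷ xs) = trans (cong (λ s → x + (x + s)) (sum-double xs)) (eq x (sum xs))
  where
  eq : ∀ x s → x + (x + 2 * s) ≡ 2 * (x + s)
  eq = solve-∀

All-double⁺ : ∀ {P : ℕ → Set} {xs} → All P xs → All P (double xs)
All-double⁺ []       = []
All-double⁺ (p ∷ ps) = p ∷ p ∷ All-double⁺ ps

All-double⁻ : ∀ {P : ℕ → Set} xs → All P (double xs) → All P xs
All-double⁻ []       _            = []
All-double⁻ (x ∷ xs) (p ∷ _ ∷ ps) = p ∷ All-double⁻ xs ps

double-decreasing⁺ : ∀ {xs} → Decreasing xs → Decreasing (double xs)
double-decreasing⁺ []       = []
double-decreasing⁺ (r ∷ rs) =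
  (≤-refl ∷ All-double⁺ r) ∷ All-double⁺ r ∷ double-decreasing⁺ rs

double-decreasing⁻ : ∀ xs → Decreasing (double xs) → Decreasing xs
double-decreasing⁻ []       _                   = []
double-decreasing⁻ (x ∷ xs) (_ ∷ r ∷ rs) = All-double⁻ xs r ∷ double-decreasing⁻ xs rs

multiplicity-double : ∀ x xs → multiplicity x (double xs) ≡ 2 * multiplicity x xs
multiplicity-double x []       = refl
multiplicity-double x (y ∷ xs) = eq (x ≟ y)
  where
  open ≡-Reasoning
  eq : Dec (x ≡ y) → multiplicity x (double (y ∷ xs)) ≡ 2 * multiplicity x (y ∷ xs)
  eq (yes refl) = begin
    multiplicity x (x ∷ x ∷ double xs)     ≡⟨ multiplicity-here x _ ⟩
    suc (multiplicity x (x ∷ double xs))   ≡⟨ cong suc (multiplicity-here x _) ⟩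
    2 + multiplicity x (double xs)         ≡⟨ cong (2 +_) (multiplicity-double x xs) ⟩
    2 + 2 * multiplicity x xs              ≡⟨ *-suc 2 _ ⟨
    2 * suc (multiplicity x xs)            ≡⟨ cong (2 *_) (multiplicity-here x xs) ⟨
    2 * multiplicity x (x ∷ xs)            ∎
  eq (no x≢y) = begin
    multiplicity x (y ∷ y ∷ double xs)     ≡⟨ multiplicity-there _ x≢y ⟩
    multiplicity x (y ∷ double xs)         ≡⟨ multiplicity-there _ x≢y ⟩
    multiplicity x (double xs)             ≡⟨ multiplicity-double x xs ⟩
    2 * multiplicity x xs                  ≡⟨ cong (2 *_) (multiplicity-there xs x≢y) ⟨
    2 * multiplicity x (y ∷ xs)            ∎

-- In a weakly decreasing list equal entries are adjacent, so if every entry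
-- occurs an even number of times then the entries pair up.
∃-double : ∀ {xs} → Decreasing xs → All (λ x → 2 ∣ multiplicity x xs) xs →
           ∃ λ ys → double ys ≡ xs
∃-double {[]}         _        _       = [] , refl
∃-double {x ∷ []}     _        (p ∷ _) =
  contradiction (subst (2 ∣_) (multiplicity-here x []) p) (2∤odd 0)
∃-double {x ∷ y ∷ zs} ((x≥y ∷ _) ∷ y≥ ∷ dec) (p ∷ _ ∷ ps) with x ≟ y
... | no x≢y = contradiction (subst (2 ∣_) once p) (2∤odd 0)
  where
  x∉zs : All (x ≢_) zs
  x∉zs = All.map (λ y≥z → >⇒≢ (≤-<-trans y≥z (≤∧≢⇒< x≥y (x≢y ∘ sym)))) y≥
  once : multiplicity x (x ∷ y ∷ zs) ≡ 1
  once = trans (multiplicity-here x (y ∷ zs)) (cong suc (multiplicity-none (x≢y ∷ x∉zs)))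
... | yes refl with ∃-double dec (All.map (λ {z} → step z) ps)
  where
  step : ∀ z → 2 ∣ multiplicity z (x ∷ x ∷ zs) → 2 ∣ multiplicity z zs
  step z 2∣m with z ≟ x
  ... | yes refl = ∣m+n∣m⇒∣n
    (subst (2 ∣_) (trans (multiplicity-here x _) (cong suc (multiplicity-here x _))) 2∣m)
    (m∣m*n 1)
  ... | no z≢x   =
    subst (2 ∣_) (trans (multiplicity-there (x ∷ zs) z≢x) (multiplicity-there zs z≢x)) 2∣m
...   | ys , eq = x ∷ ys , cong (λ l → x ∷ x ∷ l) eq

-- Conjugation

-- The conjugate of a weakly decreasing list of naturals, which may end in zeros:
-- adding a first row of length t adds 1 to each existing column and
-- creates columns of height 1 up to a total of t columns.
conjugate : List ℕ → List ℕ
conjugate []       = []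
conjugate (t ∷ ts) = map suc (conjugate ts) ++ replicate (t ∸ length (conjugate ts)) 1

-- The number of columns is the length of the first row; in particular the
-- subtraction in the definition of conjugate is exact on weakly decreasing lists.
mutual

  length-conjugate : ∀ {t ts} → Decreasing (t ∷ ts) → length (conjugate (t ∷ ts)) ≡ t
  length-conjugate {t} {ts} (t≥ ∷ dec) = begin
    length (map suc cs ++ replicate k 1)           ≡⟨ length-++ (map suc cs) ⟩
    length (map suc cs) + length (replicate k 1)
      ≡⟨ cong₂ _+_ (length-map suc cs) (length-replicate k) ⟩
    length cs + (t ∸ length cs)                    ≡⟨ m+[n∸m]≡n (length-conjugate-≤ t≥ dec) ⟩
    t                                              ∎
    where
    open ≡-Reasoning
    cs = conjugate ts
    k  = t ∸ length cs

  length-conjugate-≤ : ∀ {t ts} → All (t ≥_) ts → Decreasing ts → length (conjugate ts) ≤ t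
  length-conjugate-≤ []        _   = z≤n
  length-conjugate-≤ (t≥ ∷ _)  dec = ≤-trans (≤-reflexive (length-conjugate dec)) t≥

≤-length-conjugate : ∀ {ts} → Decreasing ts → All (length (conjugate ts) ≥_) ts
≤-length-conjugate []                 = []
≤-length-conjugate {t ∷ ts} (t≥ ∷ dec) = subst (λ n → All (n ≥_) (t ∷ ts))
  (sym (length-conjugate (t≥ ∷ dec))) (≤-refl ∷ t≥)

sum-map-suc : ∀ xs → sum (map suc xs) ≡ length xs + sum xs
sum-map-suc []       = refl
sum-map-suc (x ∷ xs) = trans (cong (suc x +_) (sum-map-suc xs)) (eq x (length xs) (sum xs))
  where
  eq : ∀ x l s → suc x + (l + s) ≡ suc l + (x + s)
  eq = solve-∀

sum-replicate : ∀ n x → sum (replicate n x) ≡ n * x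
sum-replicate zero    x = refl
sum-replicate (suc n) x = cong (x +_) (sum-replicate n x)

sum-conjugate : ∀ {ts} → Decreasing ts → sum (conjugate ts) ≡ sum ts
sum-conjugate []                       = refl
sum-conjugate {t ∷ ts} (t≥ ∷ dec) = begin
  sum (map suc cs ++ replicate k 1)           ≡⟨ sum-++ (map suc cs) _ ⟩
  sum (map suc cs) + sum (replicate k 1)
    ≡⟨ cong₂ _+_ (sum-map-suc cs) (trans (sum-replicate k 1) (*-identityʳ k)) ⟩
  length cs + sum cs + k                      ≡⟨ eq (length cs) (sum cs) k ⟩
  length cs + k + sum cs
    ≡⟨ cong₂ _+_ (m+[n∸m]≡n (length-conjugate-≤ t≥ dec)) (sum-conjugate dec) ⟩
  t + sum ts                                  ∎
  where
  open ≡-Reasoning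
  cs = conjugate ts
  k  = t ∸ length cs
  eq : ∀ l s k → l + s + k ≡ l + k + s
  eq = solve-∀

conjugate-bounds : ∀ ts → All (λ c → 1 ≤ c × c ≤ length ts) (conjugate ts)
conjugate-bounds []       = []
conjugate-bounds (t ∷ ts) = All.++⁺
  (All.map⁺ (All.map (λ (_ , c≤) → s≤s z≤n , s≤s c≤) (conjugate-bounds ts)))
  (All.replicate⁺ _ (≤-refl , s≤s z≤n))

conjugate-decreasing : ∀ ts → Decreasing (conjugate ts)
conjugate-decreasing []       = []
conjugate-decreasing (t ∷ ts) = AllPairs.++⁺
  (AllPairs.map⁺ (AllPairs.map s≤s (conjugate-decreasing ts)))
  (replicate-decreasing (t ∸ length (conjugate ts)) 1)
  (All.map⁺ (All.universal (λ _ → All.replicate⁺ _ (s≤s z≤n)) _))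

-- The number of columns recovers the first row, and the columns of height at
-- least 2 recover the conjugate of the remaining rows.
conjugate-injective : ∀ {ts us} → Decreasing ts → Decreasing us → length ts ≡ length us →
                      conjugate ts ≡ conjugate us → ts ≡ us
conjugate-injective [] [] _ _ = refl
conjugate-injective {t ∷ ts} {u ∷ us} dt@(_ ∷ dts) du@(_ ∷ dus) len eq =
  cong₂ _∷_
    (trans (sym (length-conjugate dt)) (trans (cong length eq) (length-conjugate du)))
    (conjugate-injective dts dus (suc-injective len) (map-injective suc-injective
      (proj₁ (prefix-split-unique (≥2 ts) (≥2 us) ones ones eq))))
  where
  ≥2 : ∀ ts → All (2 ≤_) (map suc (conjugate ts))
  ≥2 ts = All.map⁺ (All.map (s≤s ∘ proj₁) (conjugate-bounds ts))
  ones : ∀ {n} → All (¬_ ∘ (2 ≤_)) (replicate n 1)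
  ones = All.replicate⁺ _ λ { (s≤s ()) }

-- A partition with all parts at most r is the conjugate of a weakly decreasing
-- list of length r: remove the first row, that is, one box from each column.
conjugate-surjective : ∀ r {cs} → Decreasing cs → All (λ c → 1 ≤ c × c ≤ r) cs →
                       ∃ λ ts → Decreasing ts × length ts ≡ r × conjugate ts ≡ cs
conjugate-surjective zero    _   []                  = [] , [] , refl , refl
conjugate-surjective zero    _   ((s≤s _ , ()) ∷ _)
conjugate-surjective (suc r) dec bounds
  with prefix-split (2 ≤?_) (λ x≥y x≱2 y≥2 → x≱2 (≤-trans y≥2 x≥y)) dec
... | as , bs , refl , as≥2 , bs≱2
  with ∃-map {f = suc} (All.map (λ { (s≤s _) → _ , refl }) as≥2)
... | as′ , refl
  with conjugate-surjective r {as′}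
         (AllPairs.map ≤-pred (AllPairs.map⁻ (proj₁ (AllPairs-++⁻ as dec))))
         (All.zipWith (λ (p , q) → ≤-pred p , ≤-pred (proj₂ q))
           (All.map⁻ as≥2 , All.map⁻ (All.++⁻ˡ as bounds)))
... | ts , dts , refl , refl =
  n ∷ ts ,
  All.map (λ ts≤ → ≤-trans ts≤ (m≤m+n _ _)) (≤-length-conjugate dts) ∷ dts ,
  refl ,
  cong (map suc (conjugate ts) ++_)
    (trans (cong (λ k → replicate k 1) (m+n∸m≡n (length (conjugate ts)) (length bs)))
           (sym (All≡⇒replicate bs≡1)))
  where
  n = length (conjugate ts) + length bs
  bs≡1 : All (_≡ 1) bs
  bs≡1 = All.zipWith (λ (b≱2 , (1≤b , _)) → ≤-antisym (≤-pred (≰⇒> b≱2)) 1≤b)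
    (bs≱2 , All.++⁻ʳ as bounds)

-- The shape of the partitions counted by EO*

-- The repetition pattern of the even parts of such a partition: nothing, or one
-- copy of the largest even part followed by a list in which every entry is
-- repeated twice. Evenness and order are imposed separately, in Shape.
data EvenBlock : List ℕ → Set where
  empty  : EvenBlock []
  oneTop : ∀ e cs → EvenBlock (e ∷ double cs)

-- The list os with every entry repeated twice, followed by es, has
-- the form required by EO*.
record Shape (os es : List ℕ) : Set where
  field
    os-decreasing : Decreasing os
    os-odd        : All (2 ∤_) os
    es-decreasing : Decreasing es
    es-positive   : All (1 ≤_) es
    es-even       : All (2 ∣_) es
    es-below-os   : All (λ o → All (o >_) es) os
    es-block      : EvenBlock es

2∤⇒positive : ∀ {x} → 2 ∤ x → 1 ≤ x
2∤⇒positive {zero}  2∤0 = contradiction (divides 0 refl) 2∤0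
2∤⇒positive {suc _} _   = s≤s z≤n

head-max : ∀ {e es} → Decreasing (e ∷ es) → All (_≤ e) (e ∷ es)
head-max (e≥ ∷ _) = ≤-refl ∷ e≥

module _ {os es} (S : Shape os es) where
  open Shape S

  odd-or-even-part : ∀ {x} → x ∈ double os ++ es →
                     (x ∈ double os × 2 ∤ x) ⊎ (x ∈ es × 2 ∣ x)
  odd-or-even-part x∈ with ∈-++⁻ (double os) x∈
  ... | inj₁ x∈os = inj₁ (x∈os , All.lookup (All-double⁺ os-odd) x∈os)
  ... | inj₂ x∈es = inj₂ (x∈es , All.lookup es-even x∈es)

  even-part : ∀ {x} → x ∈ double os ++ es → 2 ∣ x → x ∈ es
  even-part x∈ 2∣x with odd-or-even-part x∈
  ... | inj₁ (_ , 2∤x)  = contradiction 2∣x 2∤x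
  ... | inj₂ (x∈es , _) = x∈es

  odd-part : ∀ {x} → x ∈ double os ++ es → 2 ∤ x → x ∈ double os
  odd-part x∈ 2∤x with odd-or-even-part x∈
  ... | inj₁ (x∈os , _) = x∈os
  ... | inj₂ (_ , 2∣x)  = contradiction 2∣x 2∤x

  shape⇒partition : IsPartition (double os ++ es)
  shape⇒partition =
    AllPairs⇒Linked (AllPairs.++⁺ (double-decreasing⁺ os-decreasing) es-decreasing
      (All-double⁺ (All.map (All.map <⇒≤) es-below-os))) ,
    All.++⁺ (All-double⁺ (All.map 2∤⇒positive os-odd)) es-positive

  shape⇒evensBelowOdds : EvensBelowOdds (double os ++ es)
  shape⇒evensBelowOdds = All.tabulate λ x∈ → All.tabulate λ y∈ 2∣x 2∤y →
    All.lookup (All.lookup (All-double⁺ es-below-os) (odd-part y∈ 2∤y)) (even-part x∈ 2∣x)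

shape⇒multiplicities : ∀ {os es x} → EvenBlock es → Shape os es → x ∈ double os ++ es →
  (IsLargestEven (double os ++ es) x → 2 ∤ multiplicity x (double os ++ es)) ×
  (¬ IsLargestEven (double os ++ es) x → 2 ∣ multiplicity x (double os ++ es))
shape⇒multiplicities {os} {x = x} empty S x∈ = largest , λ _ → even-everywhere
  where
  -- There are no even parts at all.
  largest : IsLargestEven (double os ++ []) x → 2 ∤ multiplicity x (double os ++ [])
  largest (2∣x , _) with () ← even-part S x∈ 2∣x
  even-everywhere : 2 ∣ multiplicity x (double os ++ [])
  even-everywhere = subst (2 ∣_) (sym (trans (multiplicity-++ x (double os) [])
    (trans (+-identityʳ _) (multiplicity-double x os)))) (m∣m*n (multiplicity x os))
shape⇒multiplicities {os} {x = x} (oneTop e cs) S x∈ = largest , other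
  where
  open ≡-Reasoning
  xs = double os ++ e ∷ double cs

  ≤e : ∀ {y} → y ∈ xs → 2 ∣ y → y ≤ e
  ≤e y∈ 2∣y = All.lookup (head-max (Shape.es-decreasing S)) (even-part S y∈ 2∣y)

  e-largest : IsLargestEven xs e
  e-largest = All.head (Shape.es-even S) , All.tabulate ≤e

  -- Half the multiplicity of x outside the distinguished copy of e.
  pairs : ℕ
  pairs = multiplicity x os + multiplicity x cs

  without-e : multiplicity x (double os) + multiplicity x (double cs) ≡ 2 * pairs
  without-e = trans (cong₂ _+_ (multiplicity-double x os) (multiplicity-double x cs))
                    (sym (*-distribˡ-+ 2 (multiplicity x os) _))

  largest : IsLargestEven xs x → 2 ∤ multiplicity x xs
  largest (2∣x , ≤x)
    with refl ← ≤-antisym (≤e x∈ 2∣x)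
                  (All.lookup ≤x (∈-++⁺ʳ (double os) (here refl)) (proj₁ e-largest))
    = subst (2 ∤_) (sym eq) (2∤odd pairs)
    where
    eq : multiplicity x xs ≡ odd pairs
    eq = begin
      multiplicity x xs                                               ≡⟨ multiplicity-++ x (double os) _ ⟩
      multiplicity x (double os) + multiplicity x (x ∷ double cs)
        ≡⟨ cong (multiplicity x (double os) +_) (multiplicity-here x (double cs)) ⟩
      multiplicity x (double os) + suc (multiplicity x (double cs))   ≡⟨ +-suc _ _ ⟩
      suc (multiplicity x (double os) + multiplicity x (double cs))   ≡⟨ cong suc without-e ⟩
      odd pairs                                                       ∎

  other : ¬ IsLargestEven xs x → 2 ∣ multiplicity x xs
  other ¬largest = subst (2 ∣_) (sym eq) (m∣m*n pairs)
    where
    eq : multiplicity x xs ≡ 2 * pairs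
    eq = begin
      multiplicity x xs                                               ≡⟨ multiplicity-++ x (double os) _ ⟩
      multiplicity x (double os) + multiplicity x (e ∷ double cs)
        ≡⟨ cong (multiplicity x (double os) +_)
             (multiplicity-there (double cs) λ { refl → ¬largest e-largest }) ⟩
      multiplicity x (double os) + multiplicity x (double cs)         ≡⟨ without-e ⟩
      2 * pairs                                                       ∎

shape⇒EO* : ∀ {os es} → Shape os es → IsEO* (double os ++ es)
shape⇒EO* S = shape⇒partition S , shape⇒evensBelowOdds S ,
  All.tabulate (shape⇒multiplicities (Shape.es-block S) S)

multiplicity-in-odds : ∀ {x as bs} → 2 ∤ x → All (2 ∣_) bs →
                       multiplicity x (as ++ bs) ≡ multiplicity x as
multiplicity-in-odds {x} {as} {bs} 2∤x bs-even = trans (multiplicity-++ x as bs)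
  (trans (cong (multiplicity x as +_)
           (multiplicity-none (All.map (λ { 2∣b refl → 2∤x 2∣b }) bs-even)))
         (+-identityʳ _))

multiplicity-in-evens : ∀ {x as bs} → 2 ∣ x → All (2 ∤_) as →
                        multiplicity x (as ++ bs) ≡ multiplicity x bs
multiplicity-in-evens {x} {as} {bs} 2∣x as-odd = trans (multiplicity-++ x as bs)
  (cong (_+ multiplicity x bs)
    (multiplicity-none (All.map (λ { 2∤a refl → 2∤a 2∣x }) as-odd)))

-- The even parts of a partition counted by EO*: all multiplicities become even
-- once one copy of the largest even part is removed.
evenBlock : ∀ {as} bs → All (2 ∤_) as → All (2 ∣_) bs → Decreasing bs →
  All (λ x → (IsLargestEven (as ++ bs) x → 2 ∤ multiplicity x (as ++ bs))
           × (¬ IsLargestEven (as ++ bs) x → 2 ∣ multiplicity x (as ++ bs))) bs →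
  EvenBlock bs
evenBlock []       _      _       _            _         = empty
evenBlock {as} (e ∷ bs) as-odd bs-even dec@(_ ∷ dec′) (_ ∷ ms)
  with ∃-double dec′ (All.tabulate λ x∈ → even-multiplicity x∈ (All.lookup ms x∈))
  where
  xs = as ++ e ∷ bs

  e-largest : IsLargestEven xs e
  e-largest = All.head bs-even ,
    All.++⁺ (All.map (λ 2∤y 2∣y → contradiction 2∣y 2∤y) as-odd)
            (All.map (λ y≤e _ → y≤e) (head-max dec))

  even-multiplicity : ∀ {x} → x ∈ bs →
    (IsLargestEven xs x → 2 ∤ multiplicity x xs) × (¬ IsLargestEven xs x → 2 ∣ multiplicity x xs) →
    2 ∣ multiplicity x bs
  even-multiplicity {x} x∈ (largest , other) with x ≟ e
  ... | yes refl = 2∤suc⇒2∣ (subst (2 ∤_)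
    (trans (multiplicity-in-evens {as = as} (proj₁ e-largest) as-odd) (multiplicity-here e bs))
    (largest e-largest))
  ... | no x≢e = subst (2 ∣_)
    (trans (multiplicity-in-evens {as = as} 2∣x as-odd) (multiplicity-there bs x≢e))
    (other λ (_ , ≤x) → x≢e (≤-antisym
      (All.lookup (head-max dec) (there x∈))
      (All.lookup ≤x (∈-++⁺ʳ as (here refl)) (proj₁ e-largest))))
    where
    2∣x = All.lookup bs-even (there x∈)
... | cs , refl = oneTop e cs

-- The condition on evens and odds places the odd parts on a prefix; the
-- multiplicity conditions then pair up the parts on both sides.
EO*⇒shape : ∀ {xs} → IsEO* xs → ∃₂ λ os es → Shape os es × xs ≡ double os ++ es
EO*⇒shape {xs} (part , below , mult)
  with dec ← partition⇒decreasing part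
  with prefix-split (λ x → ¬? (2 ∣? x))
         (λ { (x≥y , x<y) ¬2∤x 2∤y →
                <⇒≱ (x<y (decidable-stable (2 ∣? _) ¬2∤x) 2∤y) x≥y })
         (AllPairs.zip (dec , tabulatePairs xs λ x∈ y∈ → All.lookup (All.lookup below x∈) y∈))
... | as , bs , refl , as-odd , bs-¬odd
  with bs-even ← All.map (decidable-stable (2 ∣? _)) bs-¬odd
  with das , dbs ← AllPairs-++⁻ as dec
  with ∃-double das (All.zipWith
         (λ (2∤x , (_ , other)) → subst (2 ∣_)
           (multiplicity-in-odds {as = as} 2∤x bs-even) (other (2∤x ∘ proj₁)))
         (as-odd , All.++⁻ˡ as mult))
... | os , refl = os , bs , shape , refl
  where
  shape : Shape os bs
  shape = record
    { os-decreasing = double-decreasing⁻ os das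
    ; os-odd        = All-double⁻ os as-odd
    ; es-decreasing = dbs
    ; es-positive   = All.++⁻ʳ as (proj₂ part)
    ; es-even       = bs-even
    ; es-below-os   = All-double⁻ os (All.tabulate λ o∈ → All.tabulate λ b∈ →
        All.lookup (All.lookup below (∈-++⁺ʳ as b∈)) (∈-++⁺ˡ o∈)
          (All.lookup bs-even b∈) (All.lookup as-odd o∈))
    ; es-block      = evenBlock bs as-odd bs-even dbs (All.++⁻ʳ as mult)
    }

-- The common parametrisation

-- The list of odd numbers 1 + 2 (k + d), one for each entry d.
oddParts : ℕ → List ℕ → List ℕ
oddParts k = map (λ d → odd (k + d))

-- The middle component ρ of the copartition with parameters δ and τ.
rectangle : List ℕ → List ℕ → List ℕ
rectangle []        τ = []
rectangle δ@(_ ∷ _) τ = replicate (length τ) (2 * length δ)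

-- The copartition (γ , ρ , σ) with parameters δ and τ.
copartition : List ℕ → List ℕ → Triple
copartition δ τ = oddParts 0 δ , rectangle δ τ , oddParts 0 τ

-- The even parts of the partition with parameter τ. If τ is nonempty then the
-- largest one is twice the length of τ and the others come in pairs.
evenParts : List ℕ → List ℕ
evenParts []        = []
evenParts τ@(_ ∷ _) = 2 * length τ ∷ double (map (2 *_) (conjugate τ))

-- The partition counted by EO* with parameters δ and τ. Shifting by the length
-- of τ makes the odd parts exceed the even parts.
partitionEO* : List ℕ → List ℕ → List ℕ
partitionEO* δ τ = double (oddParts (length τ) δ) ++ evenParts τ

-- Sizes

sum-oddParts : ∀ k δ → sum (oddParts k δ) ≡ odd k * length δ + 2 * sum δ
sum-oddParts k []      = sym (trans (+-identityʳ _) (*-zeroʳ (odd k)))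
sum-oddParts k (d ∷ δ) = trans (cong (odd (k + d) +_) (sum-oddParts k δ))
  (eq k d (length δ) (sum δ))
  where
  eq : ∀ k d l s → (1 + 2 * (k + d)) + ((1 + 2 * k) * l + 2 * s)
                 ≡ (1 + 2 * k) * (1 + l) + 2 * (d + s)
  eq = solve-∀

sum-rectangle : ∀ δ τ → sum (rectangle δ τ) ≡ length τ * (2 * length δ)
sum-rectangle []        τ = sym (*-zeroʳ (length τ))
sum-rectangle δ@(_ ∷ _) τ = sum-replicate (length τ) (2 * length δ)

sum-map-2* : ∀ xs → sum (map (2 *_) xs) ≡ 2 * sum xs
sum-map-2* []       = refl
sum-map-2* (x ∷ xs) = trans (cong (2 * x +_) (sum-map-2* xs)) (sym (*-distribˡ-+ 2 x (sum xs)))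

sum-evenParts : ∀ {τ} → Decreasing τ → sum (evenParts τ) ≡ 2 * length τ + 2 * (2 * sum τ)
sum-evenParts {[]}        _   = refl
sum-evenParts {τ@(_ ∷ _)} dec = cong (2 * length τ +_) (begin
  sum (double (map (2 *_) (conjugate τ)))   ≡⟨ sum-double (map (2 *_) (conjugate τ)) ⟩
  2 * sum (map (2 *_) (conjugate τ))        ≡⟨ cong (2 *_) (sum-map-2* (conjugate τ)) ⟩
  2 * (2 * sum (conjugate τ))               ≡⟨ cong (λ s → 2 * (2 * s)) (sum-conjugate dec) ⟩
  2 * (2 * sum τ)                           ∎)
  where open ≡-Reasoning

sum-partitionEO* : ∀ δ {τ} → Decreasing τ → sum (partitionEO* δ τ) ≡ 2 * size (copartition δ τ)
sum-partitionEO* δ {τ} dec = begin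
  sum (double (oddParts r δ) ++ evenParts τ)             ≡⟨ sum-++ (double (oddParts r δ)) _ ⟩
  sum (double (oddParts r δ)) + sum (evenParts τ)
    ≡⟨ cong₂ _+_ (trans (sum-double (oddParts r δ)) (cong (2 *_) (sum-oddParts r δ)))
                 (sum-evenParts dec) ⟩
  2 * (odd r * s + 2 * sum δ) + (2 * r + 2 * (2 * sum τ))
    ≡⟨ eq r s (sum δ) (sum τ) ⟩
  2 * (1 * s + 2 * sum δ + (r * (2 * s) + (1 * r + 2 * sum τ)))
    ≡⟨ cong (2 *_) (cong₂ _+_ (sum-oddParts 0 δ)
                      (cong₂ _+_ (sum-rectangle δ τ) (sum-oddParts 0 τ))) ⟨
  2 * size (copartition δ τ)                             ∎
  where
  open ≡-Reasoning
  r = length τ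
  s = length δ
  eq : ∀ r s a b → 2 * ((1 + 2 * r) * s + 2 * a) + (2 * r + 2 * (2 * b))
                 ≡ 2 * (1 * s + 2 * a + (r * (2 * s) + (1 * r + 2 * b)))
  eq = solve-∀

-- Both parametrisations are bijective

oddParts-injective : ∀ k {δ δ′} → oddParts k δ ≡ oddParts k δ′ → δ ≡ δ′
oddParts-injective k = map-injective (λ eq → +-cancelˡ-≡ k _ _ (odd-injective eq))

oddParts-decreasing⁺ : ∀ k {δ} → Decreasing δ → Decreasing (oddParts k δ)
oddParts-decreasing⁺ k dec =
  AllPairs.map⁺ (AllPairs.map (λ d≥e → s≤s (*-monoʳ-≤ 2 (+-monoʳ-≤ k d≥e))) dec)

oddParts-decreasing⁻ : ∀ k {δ} → Decreasing (oddParts k δ) → Decreasing δ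
oddParts-decreasing⁻ k dec =
  AllPairs.map (λ p → +-cancelˡ-≤ k _ _ (*-cancelˡ-≤ 2 (≤-pred p))) (AllPairs.map⁻ dec)

copartition-injective : ∀ {δ δ′ τ τ′} → copartition δ τ ≡ copartition δ′ τ′ → δ ≡ δ′ × τ ≡ τ′
copartition-injective eq =
  oddParts-injective 0 (cong proj₁ eq) , oddParts-injective 0 (cong (proj₂ ∘ proj₂) eq)

copartition-valid : ∀ {δ τ} → Decreasing δ → Decreasing τ → IsCopartition 1 1 2 (copartition δ τ)
copartition-valid {δ} {τ} dδ dτ =
  (oddPartition dδ , rectanglePartition δ , oddPartition dτ) ,
  congruences δ , congruences τ , isRectangle δ
  where
  positive : ∀ δ → All (1 ≤_) (oddParts 0 δ)
  positive δ = All.map⁺ (All.universal (λ _ → s≤s z≤n) δ)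

  oddPartition : ∀ {δ} → Decreasing δ → IsPartition (oddParts 0 δ)
  oddPartition {δ} dδ = AllPairs⇒Linked (oddParts-decreasing⁺ 0 dδ) , positive δ

  rectanglePartition : ∀ δ → IsPartition (rectangle δ τ)
  rectanglePartition []        = AllPairs⇒Linked [] , []
  rectanglePartition (_ ∷ _) =
    AllPairs⇒Linked (replicate-decreasing (length τ) _) , All.replicate⁺ (length τ) (s≤s z≤n)

  congruences : ∀ δ → All (λ x → 1 ≤ x × x % 2 ≡ 1) (oddParts 0 δ)
  congruences δ = All.map⁺ (All.universal (λ d → s≤s z≤n , odd%2 d) δ)

  isRectangle : ∀ δ → IsRectangle 1 1 2 (oddParts 0 δ) (rectangle δ τ) (oddParts 0 τ)
  isRectangle []      = refl
  isRectangle (d ∷ δ) =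
    trans (length-replicate (length τ)) (sym (length-map odd τ)) ,
    All.replicate⁺ (length τ) (cong (λ l → 2 * suc l) (sym (length-map odd δ)))

copartition-surjective : ∀ {t} → IsCopartition 1 1 2 t →
  ∃₂ λ δ τ → Decreasing δ × Decreasing τ × t ≡ copartition δ τ
copartition-surjective {γ , ρ , σ} ((γ-part , _ , σ-part) , γ-odd , σ-odd , rect)
  with ∃-map (All.map (%2≡1⇒odd ∘ proj₂) γ-odd) | ∃-map (All.map (%2≡1⇒odd ∘ proj₂) σ-odd)
... | δ , refl | τ , refl =
  δ , τ , decreasing γ-part , decreasing σ-part ,
  cong (λ ρ → oddParts 0 δ , ρ , oddParts 0 τ) (ρ≡ δ rect)
  where
  decreasing : ∀ {δ} → IsPartition (oddParts 0 δ) → Decreasing δ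
  decreasing = oddParts-decreasing⁻ 0 ∘ partition⇒decreasing

  ρ≡ : ∀ δ → IsRectangle 1 1 2 (oddParts 0 δ) ρ (oddParts 0 τ) → ρ ≡ rectangle δ τ
  ρ≡ []      refl         = refl
  ρ≡ (d ∷ δ) (len , all≡) = trans (All≡⇒replicate all≡)
    (cong₂ replicate (trans len (length-map odd τ)) (cong (λ l → 2 * suc l) (length-map odd δ)))

evenParts-injective : ∀ {τ τ′} → Decreasing τ → Decreasing τ′ →
                      evenParts τ ≡ evenParts τ′ → τ ≡ τ′
evenParts-injective {[]}    {[]}    _  _   _  = refl
evenParts-injective {_ ∷ _} {_ ∷ _} dτ dτ′ eq with ∷-injective eq
... | len , eq′ = conjugate-injective dτ dτ′ (*-cancelˡ-≡ _ _ 2 len)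
  (map-injective (*-cancelˡ-≡ _ _ 2) (double-injective eq′))

evenParts-even : ∀ τ → All (2 ∣_) (evenParts τ)
evenParts-even []        = []
evenParts-even τ@(_ ∷ _) = m∣m*n (length τ) ∷
  All-double⁺ (All.map⁺ (All.universal m∣m*n (conjugate τ)))

oddParts-odd : ∀ k δ → All (2 ∤_) (oddParts k δ)
oddParts-odd k δ = All.map⁺ (All.universal (λ d → 2∤odd (k + d)) δ)

partitionEO*-injective : ∀ {δ δ′ τ τ′} → Decreasing τ → Decreasing τ′ →
  partitionEO* δ τ ≡ partitionEO* δ′ τ′ → δ ≡ δ′ × τ ≡ τ′
partitionEO*-injective {δ} {δ′} {τ} {τ′} dτ dτ′ eq
  with prefix-split-unique (odds τ δ) (odds τ′ δ′) (evens τ) (evens τ′) eq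
  where
  odds : ∀ τ δ → All (2 ∤_) (double (oddParts (length τ) δ))
  odds τ δ = All-double⁺ (oddParts-odd (length τ) δ)
  evens : ∀ τ → All (λ x → ¬ 2 ∤ x) (evenParts τ)
  evens τ = All.map contradiction (evenParts-even τ)
... | odds≡ , evens≡ with evenParts-injective dτ dτ′ evens≡
...   | refl = oddParts-injective (length τ) (double-injective odds≡) , refl

evenParts≤ : ∀ τ → All (_≤ 2 * length τ) (evenParts τ)
evenParts≤ []        = []
evenParts≤ τ@(_ ∷ _) = ≤-refl ∷
  All-double⁺ (All.map⁺ (All.map (*-monoʳ-≤ 2 ∘ proj₂) (conjugate-bounds τ)))

evenParts-decreasing : ∀ τ → Decreasing (evenParts τ)
evenParts-decreasing []        = []
evenParts-decreasing τ@(_ ∷ _) = All.tail (evenParts≤ τ) ∷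
  double-decreasing⁺ (AllPairs.map⁺ (AllPairs.map (*-monoʳ-≤ 2) (conjugate-decreasing τ)))

partitionEO*-shape : ∀ {δ} → Decreasing δ → ∀ τ → Shape (oddParts (length τ) δ) (evenParts τ)
partitionEO*-shape {δ} dδ τ = record
  { os-decreasing = oddParts-decreasing⁺ (length τ) dδ
  ; os-odd        = oddParts-odd (length τ) δ
  ; es-decreasing = evenParts-decreasing τ
  ; es-positive   = positive τ
  ; es-even       = evenParts-even τ
  ; es-below-os   = All.map⁺ (All.universal (λ d → All.map
      (λ e≤ → s≤s (≤-trans e≤ (*-monoʳ-≤ 2 (m≤m+n (length τ) d)))) (evenParts≤ τ)) δ)
  ; es-block      = block τ
  }
  where
  positive : ∀ τ → All (1 ≤_) (evenParts τ)
  positive []        = []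
  positive τ@(_ ∷ _) = s≤s z≤n ∷ All-double⁺ (All.map⁺
    (All.map (λ {c} (1≤c , _) → ≤-trans 1≤c (m≤m+n c _)) (conjugate-bounds τ)))

  block : ∀ τ → EvenBlock (evenParts τ)
  block []        = empty
  block τ@(_ ∷ _) = oneTop (2 * length τ) (map (2 *_) (conjugate τ))

oddParts-surjective : ∀ k {os} → Decreasing os → All (2 ∤_) os → All (2 * k <_) os →
                      ∃ λ δ → Decreasing δ × oddParts k δ ≡ os
oddParts-surjective k {os} dec os-odd above
  with ∃-map {f = λ d → odd (k + d)} (All.zipWith preimage (os-odd , above))
  where
  preimage : ∀ {o} → 2 ∤ o × 2 * k < o → ∃ λ d → odd (k + d) ≡ o
  preimage (2∤o , 2k<o) with 2∤⇒odd 2∤o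
  ... | p , refl = p ∸ k , cong odd (m+[n∸m]≡n {k} {p} (*-cancelˡ-≤ 2 (≤-pred 2k<o)))
... | δ , refl = δ , oddParts-decreasing⁻ k dec , refl

evenParts-surjective : ∀ {es} → EvenBlock es → Decreasing es → All (1 ≤_) es → All (2 ∣_) es →
                       ∃ λ τ → Decreasing τ × evenParts τ ≡ es
evenParts-surjective empty         _          _          _            = [] , [] , refl
evenParts-surjective (oneTop e cs) (e≥ ∷ dec) (1≤e ∷ 1≤) (2∣e ∷ 2∣cs)
  with 2∣⇒double 2∣e | ∃-map (All.map 2∣⇒double (All-double⁻ cs 2∣cs))
... | k , refl | bs , refl
  with conjugate-surjective k
         (AllPairs.map (*-cancelˡ-≤ 2) (AllPairs.map⁻ (double-decreasing⁻ cs dec)))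
         (All.zipWith (λ (1≤2b , 2b≤2k) → positive 1≤2b , *-cancelˡ-≤ 2 2b≤2k)
           (All.map⁻ (All-double⁻ cs 1≤) , All.map⁻ (All-double⁻ cs e≥)))
  where
  positive : ∀ {b} → 1 ≤ 2 * b → 1 ≤ b
  positive {suc _} _ = s≤s z≤n
... | []        , _  , refl , _    = contradiction 1≤e λ ()
... | τ@(_ ∷ _) , dτ , refl , refl = τ , dτ , refl

partitionEO*-surjective : ∀ {xs} → IsEO* xs →
  ∃₂ λ δ τ → Decreasing δ × Decreasing τ × xs ≡ partitionEO* δ τ
partitionEO*-surjective eo with EO*⇒shape eo
... | os , es , S , refl
  with evenParts-surjective es-block es-decreasing es-positive es-even
  where open Shape S
... | τ , dτ , refl
  with oddParts-surjective (length τ) os-decreasing os-odd 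
         (All.zipWith (above τ) (os-odd , es-below-os))
  where
  open Shape S
  above : ∀ τ {o} → 2 ∤ o × All (o >_) (evenParts τ) → 2 * length τ < o
  -- Without even parts the bound says only that odd numbers are positive.
  above []      (2∤o , _)     = 2∤⇒positive 2∤o
  above (_ ∷ _) (_ , 2k< ∷ _) = 2k<
... | δ , dδ , refl = δ , τ , dδ , dτ , refl

-- A copartition and a partition with the same parameters.
Corresponds : Triple → List ℕ → Set
Corresponds t xs = ∃₂ λ δ τ → Decreasing δ × Decreasing τ ×
                              t ≡ copartition δ τ × xs ≡ partitionEO* δ τ

corresponds-injectiveˡ : ∀ {t t′ xs} → Corresponds t xs → Corresponds t′ xs → t ≡ t′
corresponds-injectiveˡ (δ , τ , _ , dτ , refl , eq) (δ′ , τ′ , _ , dτ′ , refl , eq′)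
  with partitionEO*-injective {δ} {δ′} dτ dτ′ (trans (sym eq) eq′)
... | refl , refl = refl

corresponds-injectiveʳ : ∀ {t xs xs′} → Corresponds t xs → Corresponds t xs′ → xs ≡ xs′
corresponds-injectiveʳ (δ , τ , _ , _ , eq , refl) (δ′ , τ′ , _ , _ , eq′ , refl)
  with copartition-injective {δ} {δ′} (trans (sym eq) eq′)
... | refl , refl = refl

theorem3p5 : ∀ (n : ℕ) → cp 1 1 2 n ≡ EO* (2 * n)
theorem3p5 n = ≤-antisym
  (length-≤ corresponds-injectiveˡ (EO*-partitions (2 * n)) (copartitions-unique 1 1 2 n) to)
  (length-≤ (λ {xs} {xs′} {t} → corresponds-injectiveʳ {t} {xs} {xs′})
    (copartitions 1 1 2 n) (EO*-partitions-unique (2 * n)) from)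
  where
  to : ∀ {t} → t ∈ copartitions 1 1 2 n →
       ∃ λ xs → xs ∈ EO*-partitions (2 * n) × Corresponds t xs
  to t∈ with Equivalence.to (∈-copartitions 1 1 2 {n}) t∈
  ... | valid , refl with copartition-surjective valid
  ... | δ , τ , dδ , dτ , refl = partitionEO* δ τ ,
    Equivalence.from ∈-EO*-partitions
      (shape⇒EO* (partitionEO*-shape dδ τ) , sum-partitionEO* δ dτ) ,
    δ , τ , dδ , dτ , refl , refl

  from : ∀ {xs} → xs ∈ EO*-partitions (2 * n) →
         ∃ λ t → t ∈ copartitions 1 1 2 n × Corresponds t xs
  from xs∈ with Equivalence.to ∈-EO*-partitions xs∈
  ... | valid , sum≡ with partitionEO*-surjective valid
  ... | δ , τ , dδ , dτ , refl = copartition δ τ ,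
    Equivalence.from (∈-copartitions 1 1 2 {n})
      (copartition-valid dδ dτ , *-cancelˡ-≡ _ n 2 (trans (sym (sum-partitionEO* δ dτ)) sum≡)) ,
    δ , τ , dδ , dτ , refl , refl
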